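{- Assume computable choice and Markov induction. For every oracle $\chi:\mathbb{N}\to\nabla_0 2$, its Turing jump $\hat\chi:\mathbb{N}\to\nabla_0 2$ satisfies $\hat\chi\not\le_T\chi$.
   Context: Setting: homotopy type theory with a univalent universe $\mathcal{U}$ of small types and higher inductive types. It is assumed that there is a small type $\Omega_{\neg\neg}:\mathcal{U}$ classifying $\neg\neg$-stable propositions. For a type $X$, $\nabla_0X$ is the type of $\xi:X\to\Omega_{\neg\neg}$ such that $\neg\neg\sum_{x:X}\xi(x)$ and $\prod_{x,y:X}\xi(x)\to\xi(y)\to\neg\neg(x=y)$; write $\xi\downarrow:=\sum_{x:X}\xi(x)$ and $\xi\downarrow=x$ for $\xi(x)$. For a higher modality $\bigcirc$, a type is $\bigcirc$-connected if $\bigcirc X$ is contractible. The nullification at a family $B:A\to\mathcal{U}$ is the higher modality whose modal types are the $X$ with every constant map $X\to X^{B(a)}$ an equivalence. An oracle is a map $\chi:A\to\nabla_0B$; $\bigcirc_\chi$ is the nullification at $a\mapsto\chi(a)\downarrow$, with unit $\eta$; $\chi\le_T\chi'$ means every $\bigcirc_\chi$-connected type is $\bigcirc_{\chi'}$-connected. An oracle $\mathbb{N}\to\nabla_0 2$ is regarded as an oracle $\mathbb{N}\to\nabla_0\mathbb{N}$ via $2\subseteq\mathbb{N}$. Computability: a function $\varphi:\mathbb{N}\times\mathbb{N}\times\mathbb{N}\to\mathbb{N}+\{\bot\}$, written $\varphi_e^k(n)$, is postulated such that for all $e,n$ at most one $k$ has $\varphi_e^k(n)\in\mathbb{N}$;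 $\varphi_e(n)\downarrow=m$ means $\sum_k\varphi_e^k(n)=m$ and $\varphi_e(n)\downarrow$ means $\sum_m\varphi_e(n)\downarrow=m$. Computable choice (CC): for every $R:\mathbb{N}\times\mathbb{N}\to\Omega_{\neg\neg}$ with $\prod_n\left(\neg\neg\sum_m R\,n\,m\to\|\sum_m R\,n\,m\|\right)$ there merely exists $e$ such that for all $n$, if $\neg\neg\sum_m R\,n\,m$ then $\varphi_e(n)\downarrow$ and $R\,n\,\varphi_e(n)$. Markov induction (MI): with $\mathtt{IsSuc}(\mu,\nu):=\prod_{m}(\mu\downarrow=m)\to(\nu\downarrow=m+1)$ on $\nabla_0\mathbb{N}$, for every $P:\nabla_0\mathbb{N}\to\mathcal{U}$ and $h:\prod_\nu(\prod_\mu\mathtt{IsSuc}(\mu,\nu)\to P(\mu))\to P(\nu)$ there is a section $\prod_\nu P(\nu)$. The coding $\psi^\chi$: fix a bijection $\theta:\mathbb{N}\cong\mathbb{N}+(\mathbb{N}\times\mathbb{N})$. For lists $\vec k=[k_1,\dots,k_m]$ of naturals and $x:\mathbb{N}+\mathbb{N}\times\mathbb{N}$ define $\psi^\chi_{\vec k}(x):\bigcirc_\chi(\mathbb{N}+\{\bot\})$ by recursion on $m$: $\psi^\chi_{[]}(\mathrm{inl}(n))=\eta(n)$, $\psi^\chi_{[]}(\mathrm{inr}(\_))=\eta(\bot)$; for $m>0$, $\psi^\chi_{[k_1,\dots,k_m]}(\mathrm{inl}(n))=\eta(\bot)$, and $\psi^\chi_{[k_1,\dots,k_m]}(\mathrm{inr}(n,e))$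 is defined inside $\bigcirc_\chi$ from the element of $\bigcirc_\chi(\chi(n)\downarrow)$: given $b$ with $\chi(n)\downarrow=b$, it is $\psi^\chi_{[k_1,\dots,k_{m-1}]}(\theta(c))$ if $\varphi_e^{k_m}(b)=c\in\mathbb{N}$, and $\eta(\bot)$ if $\varphi_e^{k_m}(b)=\bot$. For $e:\mathbb{N}$, $\psi^\chi(e)$ is the partial element of $\bigcirc_\chi\mathbb{N}$ with domain $\psi^\chi(e)\downarrow:=\bigcirc_\chi\sum_{\vec k}\sum_{n:\mathbb{N}}\psi^\chi_{\vec k}(\theta(e))=\eta(n)$ and value obtained by applying $\bigcirc_\chi$ to the projection to $n$; $\psi^\chi(e)\downarrow=z$ means the domain holds with value $z$. The Turing jump: let $J(n)$ be the proposition $\left\|\sum_{d:\varphi_n(n)\downarrow}\psi^\chi(\varphi_n(n))\downarrow=\eta(0)\right\|$; then $\hat\chi(n):\nabla_0 2$ is the element $\xi$ with $\xi(1):=\neg\neg J(n)$ and $\xi(0):=\neg J(n)$ (so $\hat\chi(n)\downarrow=1$ iff $J(n)$, and $\hat\chi(n)\downarrow=0$ otherwise). -}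

{-# OPTIONS --without-K #-}
module Defs where

open import Axiom.Extensionality.Propositional using (Extensionality)
open import Data.Fin.Base using (Fin; zero; suc; toℕ)
open import Data.List.Base using (List; []; _∷_)
open import Data.Maybe.Base using (Maybe; just; nothing)
open import Data.Nat.Base using (ℕ; zero; suc)
open import Data.Product.Base using (Σ-syntax; _×_; _,_; proj₁; proj₂)
open import Data.Sum.Base using (_⊎_; inj₁; inj₂)
open import Data.Empty using (⊥-elim)
open import Function.Base using (const; id; _∘_)
open import Function.Bundles using (_⇔_; _↔_; Equivalence; Inverse)
open import Level using (0ℓ)
open import Relation.Binary.PropositionalEquality using (_≡_; refl; sym; trans; cong)
open import Relation.Nullary using (¬_; Irrelevant; Stable)
open import Relation.Nullary.Negation.Core using (negated-stable)

-- `Set` plays the role of the universe 𝒰 and `_≡_` that of its identity types.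

IsContr : Set → Set
IsContr X = Σ[ x ∈ X ] (∀ y → x ≡ y)

-- Bi-invertibility, which unlike the mere existence of a two-sided inverse is
-- the correct notion of equivalence in the absence of K.
IsEquiv : {X Y : Set} → (X → Y) → Set
IsEquiv {X} {Y} f =
  (Σ[ g ∈ (Y → X) ] (∀ y → f (g y) ≡ y)) × (Σ[ h ∈ (Y → X) ] (∀ x → h (f x) ≡ x))

record PropositionalTruncation : Set₁ where
  field
    ‖_‖           : Set → Set
    ∣_∣           : {A : Set} → A → ‖ A ‖
    ‖‖-irrelevant : {A : Set} → Irrelevant ‖ A ‖
    ‖‖-rec        : {A P : Set} → Irrelevant P → (A → P) → ‖ A ‖ → P

-- Higher modalities in the sense of Rijke, Shulman and Spitters.
record HigherModality : Set₁ where
  field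
    ○      : Set → Set
    η      : ∀ {X} → X → ○ X
    ○-ind  : ∀ {X} (P : ○ X → Set) → (∀ x → ○ (P (η x))) → ∀ z → ○ (P z)
    ○-comp : ∀ {X} (P : ○ X → Set) (f : ∀ x → ○ (P (η x))) x → ○-ind P f (η x) ≡ f x

  IsModal : Set → Set
  IsModal X = IsEquiv (η {X})

  field
    ≡-modal : ∀ {X} (z z′ : ○ X) → IsModal (z ≡ z′)

  bind : ∀ {X Y} → ○ X → (X → ○ Y) → ○ Y
  bind {Y = Y} z f = ○-ind (const Y) f z

  ○-map : ∀ {X Y} → (X → Y) → ○ X → ○ Y
  ○-map f z = bind z (η ∘ f)

  IsConnected : Set → Set
  IsConnected X = IsContr (○ X)

  ○-modal : ∀ X → IsModal (○ X)
  ○-modal X = (join , η-join) , (join , ○-comp (const X) id)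
    where
    join : ○ (○ X) → ○ X
    join = ○-ind (const X) id

    η-join : ∀ w → η (join w) ≡ w
    η-join w = proj₁ (proj₂ (≡-modal (η (join w)) w))
      (○-ind (λ w → η (join w) ≡ w) (λ z → η (cong η (○-comp (const X) id z))) w)

IsNull : {A : Set} → (A → Set) → Set → Set
IsNull B X = ∀ a → IsEquiv (const {A = X} {B = B a})

-- The specification determines the modality up to equivalence.
record Nullification {A : Set} (B : A → Set) : Set₁ where
  field
    modality   : HigherModality
  open HigherModality modality public
  field
    modal⇔null : ∀ X → IsModal X ⇔ IsNull B X

  generator : ∀ a → ○ (B a)
  generator a = proj₁ (proj₁ (Equivalence.to (modal⇔null (○ (B a))) (○-modal (B a)) a)) η

-- A small type Ω classifying the ¬¬-stable propositions.  Equality of codes is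
-- logical equivalence of the coded propositions.
record StableClassifier : Set₁ where
  field
    Ω             : Set
    ⟦_⟧           : Ω → Set
    ⟦⟧-irrelevant : ∀ p → Irrelevant ⟦ p ⟧
    ⟦⟧-stable     : ∀ p → Stable ⟦ p ⟧
    code          : (P : Set) → Irrelevant P → Stable P → Ω
    code⇔         : ∀ P (i : Irrelevant P) (s : Stable P) → ⟦ code P i s ⟧ ⇔ P
    Ω-ext         : ∀ p q → ⟦ p ⟧ ⇔ ⟦ q ⟧ → p ≡ q

-- What is used of homotopy type theory beyond Agda's own type formers.  Higher
-- inductive types enter through their universal properties.  Univalence is
-- deliberately left out: it would contradict axiom K, so that anyone working
-- with K could prove everything from it.
record Foundations : Set₁ where
  field
    funext     : Extensionality 0ℓ 0ℓ
    truncation : PropositionalTruncation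
    nullify    : {A : Set} (B : A → Set) → Nullification B
    classifier : StableClassifier

-- φ k e n is φₑᵏ(n); `nothing` is ⊥.
record PartialFunctions : Set where
  field
    φ        : ℕ → ℕ → ℕ → Maybe ℕ
    φ-unique : ∀ {k k′ e n m m′} → φ k e n ≡ just m → φ k′ e n ≡ just m′ → k ≡ k′

  eval_at_↓=_ : ℕ → ℕ → ℕ → Set
  eval e at n ↓= m = Σ[ k ∈ ℕ ] φ k e n ≡ just m

  eval_at_↓ : ℕ → ℕ → Set
  eval e at n ↓ = Σ[ m ∈ ℕ ] eval e at n ↓= m

module Oracles (F : Foundations) where

  open Foundations F public
  open PropositionalTruncation truncation public
  open StableClassifier classifier public

  ¬-irrelevant : {P : Set} → Irrelevant (¬ P)
  ¬-irrelevant f g = funext λ x → ⊥-elim (f x)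

  ¬-code : Set → Ω
  ¬-code P = code (¬ P) ¬-irrelevant negated-stable

  ¬-code⇔ : ∀ P → ⟦ ¬-code P ⟧ ⇔ (¬ P)
  ¬-code⇔ P = code⇔ (¬ P) ¬-irrelevant negated-stable

  ∇₀ : Set → Set
  ∇₀ X = Σ[ ξ ∈ (X → Ω) ]
    (¬ ¬ (Σ[ x ∈ X ] ⟦ ξ x ⟧)) × (∀ x y → ⟦ ξ x ⟧ → ⟦ ξ y ⟧ → ¬ ¬ (x ≡ y))

  _↓=_ : {X : Set} → ∇₀ X → X → Set
  ξ ↓= x = ⟦ proj₁ ξ x ⟧

  _↓ : {X : Set} → ∇₀ X → Set
  _↓ {X} ξ = Σ[ x ∈ X ] (ξ ↓= x)

  -- The double negation makes the image relation ¬¬-stable.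
  ∇₀-map : {X Y : Set} → (X → Y) → ∇₀ X → ∇₀ Y
  ∇₀-map {X} {Y} f ξ = image , total , unique
    where
    Preimage : Y → Set
    Preimage y = Σ[ x ∈ X ] (f x ≡ y × ξ ↓= x)

    image : Y → Ω
    image y = ¬-code (¬ Preimage y)

    total : ¬ ¬ (Σ[ y ∈ Y ] ⟦ image y ⟧)
    total k = proj₁ (proj₂ ξ) λ (x , p) →
      k (f x , Equivalence.from (¬-code⇔ (¬ Preimage (f x))) (λ h → h (x , refl , p)))

    unique : ∀ y y′ → ⟦ image y ⟧ → ⟦ image y′ ⟧ → ¬ ¬ (y ≡ y′)
    unique y y′ p p′ k =
      Equivalence.to (¬-code⇔ (¬ Preimage y)) p λ (x , fx≡y , q) →
      Equivalence.to (¬-code⇔ (¬ Preimage y′)) p′ λ (x′ , fx′≡y′ , q′) →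
      proj₂ (proj₂ ξ) x x′ q q′ λ x≡x′ →
      k (trans (sym fx≡y) (trans (cong f x≡x′) fx′≡y′))

  Oracle : Set → Set → Set
  Oracle A B = A → ∇₀ B

  oracleModality : {A B : Set} (χ : Oracle A B) → Nullification (λ a → χ a ↓)
  oracleModality χ = nullify (λ a → χ a ↓)

  _≤T_ : {A B A′ B′ : Set} → Oracle A B → Oracle A′ B′ → Set₁
  χ ≤T χ′ = (X : Set) → Nullification.IsConnected (oracleModality χ) X →
                        Nullification.IsConnected (oracleModality χ′) X

  fromBinary : Oracle ℕ (Fin 2) → Oracle ℕ ℕ
  fromBinary χ n = ∇₀-map toℕ (χ n)

  IsSuc : ∇₀ ℕ → ∇₀ ℕ → Set
  IsSuc μ ν = ∀ m → μ ↓= m → ν ↓= suc m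

  MarkovInduction : Set₁
  MarkovInduction = (P : ∇₀ ℕ → Set) →
    (∀ ν → (∀ μ → IsSuc μ ν → P μ) → P ν) → ∀ ν → P ν

  module Computability (C : PartialFunctions) where

    open PartialFunctions C public

    ComputableChoice : Set
    ComputableChoice = (R : ℕ → ℕ → Ω) →
      (∀ n → ¬ ¬ (Σ[ m ∈ ℕ ] ⟦ R n m ⟧) → ‖ (Σ[ m ∈ ℕ ] ⟦ R n m ⟧) ‖) →
      ‖ (Σ[ e ∈ ℕ ] (∀ n → ¬ ¬ (Σ[ m ∈ ℕ ] ⟦ R n m ⟧) →
           Σ[ d ∈ eval e at n ↓ ] ⟦ R n (proj₁ d) ⟧)) ‖

    module Coding (θ : ℕ ↔ (ℕ ⊎ ℕ × ℕ)) (χ : Oracle ℕ ℕ) where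

      open Nullification (oracleModality χ)

      -- The list [k₁,…,kₘ] is stored with kₘ at its head.
      ψ-steps : List ℕ → ℕ ⊎ ℕ × ℕ → ○ (Maybe ℕ)
      ψ-next  : List ℕ → Maybe ℕ → ○ (Maybe ℕ)

      ψ-steps []       (inj₁ n)       = η (just n)
      ψ-steps []       (inj₂ _)       = η nothing
      ψ-steps (k ∷ ks) (inj₁ n)       = η nothing
      ψ-steps (k ∷ ks) (inj₂ (n , e)) = bind (generator n) λ (b , _) → ψ-next ks (φ k e b)

      ψ-next ks (just c) = ψ-steps ks (Inverse.to θ c)
      ψ-next ks nothing  = η nothing

      ψ_↓ : ℕ → Set
      ψ e ↓ = ○ (Σ[ ks ∈ List ℕ ] Σ[ n ∈ ℕ ] ψ-steps ks (Inverse.to θ e) ≡ η (just n))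

      ψ-value : ∀ e → ψ e ↓ → ○ ℕ
      ψ-value e = ○-map λ (_ , n , _) → n

      ψ_↓=_ : ℕ → ○ ℕ → Set
      ψ e ↓= z = Σ[ d ∈ ψ e ↓ ] ψ-value e d ≡ z

      Halts : ℕ → Set
      Halts n = ‖ (Σ[ d ∈ eval n at n ↓ ] ψ proj₁ d ↓= η 0) ‖

    jump : (ℕ ↔ (ℕ ⊎ ℕ × ℕ)) → Oracle ℕ (Fin 2) → Oracle ℕ (Fin 2)
    jump θ χ n = ξ , total , unique
      where
      J : Set
      J = Coding.Halts θ (fromBinary χ) n

      ξ : Fin 2 → Ω
      ξ zero       = ¬-code J
      ξ (suc zero) = ¬-code (¬ J)

      total : ¬ ¬ (Σ[ b ∈ Fin 2 ] ⟦ ξ b ⟧)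
      total k = k (zero , Equivalence.from (¬-code⇔ J) λ j →
                k (suc zero , Equivalence.from (¬-code⇔ (¬ J)) (λ h → h j)))

      unique : ∀ x y → ⟦ ξ x ⟧ → ⟦ ξ y ⟧ → ¬ ¬ (x ≡ y)
      unique zero       zero       _ _ k = k refl
      unique (suc zero) (suc zero) _ _ k = k refl
      unique zero       (suc zero) p q _ =
        Equivalence.to (¬-code⇔ (¬ J)) q (Equivalence.to (¬-code⇔ J) p)
      unique (suc zero) zero       p q _ =
        Equivalence.to (¬-code⇔ (¬ J)) p (Equivalence.to (¬-code⇔ J) q)

{-# OPTIONS --without-K #-}
module Submission where

open import Defs
open import Data.Empty using (⊥-elim)
open import Data.Fin.Base using (Fin; zero; suc; toℕ)
open import Data.List.Base using ([]; _∷_)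
open import Data.Maybe.Base using (just; nothing)
open import Data.Maybe.Properties using (just-injective)
open import Data.Nat.Base using (ℕ; zero; suc)
open import Data.Product.Base using (Σ-syntax; _×_; _,_; proj₁; proj₂)
open import Data.Sum.Base using (_⊎_; inj₁; inj₂)
open import Function.Base using (const; _∘_)
open import Function.Bundles using (_↔_; Equivalence; Inverse; mk⇔)
open import Relation.Binary.PropositionalEquality
  using (_≡_; refl; sym; trans; cong; cong-app; subst)
open import Relation.Nullary using (¬_; Irrelevant; Stable)

-- Suppose the jump of χ reduces to χ.  Its values then live in ○ = ○_χ, giving
-- z n : ○ ℕ for every n.  "Some code computes z" is a modal proposition of
-- z : ○ ℕ, because computable choice merges codes given for each answer b to a
-- query n into one code that performs the query; so it holds for every z by
-- induction on ○.  A second use of computable choice gives an e such that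
-- ψ (φₑ(n)) computes z n for all n, and n = e is contradictory: to refute
-- anything we may assume that elements of ○ are of the form η x.

-- Elimination for modalities and connectedness of generators.

module _ (M : HigherModality) where

  open HigherModality M

  modal-ind : {X : Set} (P : ○ X → Set) → (∀ z → IsModal (P z)) →
              (∀ x → P (η x)) → ∀ z → P z
  modal-ind P m f z = proj₁ (proj₂ (m z)) (○-ind P (η ∘ f) z)

  modal-rec : {X Y : Set} → IsModal Y → (X → Y) → ○ X → Y
  modal-rec {Y = Y} m = modal-ind (const Y) (const m)

  modal-rec-η : {X Y : Set} (m : IsModal Y) (f : X → Y) (x : X) →
                modal-rec m f (η x) ≡ f x
  modal-rec-η m f x =
    trans (cong (proj₁ (proj₂ m)) (○-comp _ (η ∘ f) x)) (proj₂ (proj₂ m) (f x))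

module _ {A : Set} {B : A → Set} (N : Nullification B) where

  open Nullification N

  generator-η : ∀ a (b : B a) → generator a ≡ η b
  generator-η a b =
    cong-app (proj₂ (proj₁ (Equivalence.to (modal⇔null (○ (B a))) (○-modal (B a)) a)) η) b

  -- Identity types of `○ (B a)` are modal, so it suffices to compare `generator a` with points
  -- `η b`.
  generator-connected : ∀ a → IsConnected (B a)
  generator-connected a =
    generator a ,
    modal-ind modality (generator a ≡_) (≡-modal (generator a)) (generator-η a)

-- Passing from a binary oracle to its image in `∇₀ ℕ`.

module _ (F : Foundations) where

  open Oracles F

  -- Precomposing with `r a` moves a map to `B′ a`, where nullness makes it constant; restricting
  -- along `s a` gives the original map back.
  null-retract : {A : Set} {B B′ : A → Set} (s : ∀ a → B a → B′ a) (r : ∀ a → B′ a → B a) →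
                 (∀ a b → r a (s a b) ≡ b) → {X : Set} → IsNull B′ X → IsNull B X
  null-retract s r r∘s null a =
    let (inv , isInv) , (inv′ , isInv′) = null a
    in ((λ h → inv (h ∘ r a)) ,
        λ h → funext λ b → trans (cong-app (isInv (h ∘ r a)) (s a b)) (cong h (r∘s a b))) ,
       ((λ h → inv′ (h ∘ r a)) , isInv′)

  ∇₀-value-unique : {X : Set} (ξ : ∇₀ X) (v w : ξ ↓) → ¬ ¬ (v ≡ w)
  ∇₀-value-unique ξ (x , p) (y , q) k = proj₂ (proj₂ ξ) x y p q λ { refl →
    k (cong (x ,_) (⟦⟧-irrelevant (proj₁ ξ x) p q)) }

  module _ (ξ : ∇₀ (Fin 2)) where

    binary-to : ξ ↓ → ∇₀-map toℕ ξ ↓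
    binary-to (i , p) = toℕ i , Equivalence.from (¬-code⇔ _) λ k → k (i , refl , p)

    binary-from : ∇₀-map toℕ ξ ↓ → ξ ↓
    binary-from (zero , p) = zero , ⟦⟧-stable _ λ k →
      Equivalence.to (¬-code⇔ _) p λ where
        (zero , _ , q) → k q
    binary-from (suc zero , p) = suc zero , ⟦⟧-stable _ λ k →
      Equivalence.to (¬-code⇔ _) p λ where
        (suc zero , _ , q) → k q
    binary-from (suc (suc _) , p) = ⊥-elim (Equivalence.to (¬-code⇔ _) p λ where
        (zero , () , _)
        (suc zero , () , _))

    binary-from-to : ∀ v → binary-from (binary-to v) ≡ v
    binary-from-to (zero , p)     = cong (zero ,_) (⟦⟧-irrelevant _ _ p)
    binary-from-to (suc zero , p) = cong (suc zero ,_) (⟦⟧-irrelevant _ _ p)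

  -- Reducibility speaks of `χ`, the coding of `fromBinary χ`. As `χ n ↓` is a retract of
  -- `fromBinary χ n ↓`, types modal for the latter are modal for the former.
  fromBinary-○ : (χ : Oracle ℕ (Fin 2)) {X : Set} →
    Nullification.○ (oracleModality χ) X → Nullification.○ (oracleModality (fromBinary χ)) X
  fromBinary-○ χ {X} = modal-rec N.modality
    (Equivalence.from (N.modal⇔null (N′.○ X))
      (null-retract (binary-to ∘ χ) (binary-from ∘ χ) (binary-from-to ∘ χ)
        (Equivalence.to (N′.modal⇔null (N′.○ X)) (N′.○-modal X))))
    N′.η
    where
    module N  = Nullification (oracleModality χ)
    module N′ = Nullification (oracleModality (fromBinary χ))

  -- Modal propositions, and `η` up to double negation.

  module _ {A B : Set} (χ : Oracle A B) where

    open Nullification (oracleModality χ)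

    proposition-modal : {P : Set} → Irrelevant P → (∀ a → (χ a ↓ → P) → P) → IsModal P
    proposition-modal i f = Equivalence.from (modal⇔null _) λ a →
      (f a , λ h → funext λ b → i _ (h b)) , (f a , λ p → i _ p)

    ¬-modal : {P : Set} → IsModal (¬ P)
    ¬-modal = proposition-modal ¬-irrelevant λ a f p →
      proj₁ (proj₂ (χ a)) λ v → f v p

    -- A map `f` on `χ a ↓` is glued to the conjunction of its values. This agrees with each `f v`,
    -- since any two answers are equal up to double negation and `f w` is stable.
    Ω-modal : IsModal Ω
    Ω-modal = Equivalence.from (modal⇔null Ω) λ a →
      (meet a , λ f → funext λ v → meet-≡ a f v) ,
      (meet a , λ p → Ω-ext _ _ (mk⇔
        (λ q → ⟦⟧-stable p λ k → proj₁ (proj₂ (χ a)) λ v → k (meet-to a (const p) q v))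
        (λ q → meet-from a (const p) (const q))))
      where
      module _ a (f : χ a ↓ → Ω) where
        meet-irrelevant : Irrelevant (∀ v → ⟦ f v ⟧)
        meet-irrelevant g h = funext λ v → ⟦⟧-irrelevant (f v) (g v) (h v)

        meet-stable : Stable (∀ v → ⟦ f v ⟧)
        meet-stable k v = ⟦⟧-stable (f v) λ l → k λ g → l (g v)

        meet : Ω
        meet = code (∀ v → ⟦ f v ⟧) meet-irrelevant meet-stable

        meet-to : ⟦ meet ⟧ → ∀ v → ⟦ f v ⟧
        meet-to = Equivalence.to (code⇔ _ meet-irrelevant meet-stable)

        meet-from : (∀ v → ⟦ f v ⟧) → ⟦ meet ⟧
        meet-from = Equivalence.from (code⇔ _ meet-irrelevant meet-stable)

        meet-≡ : ∀ v → meet ≡ f v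
        meet-≡ v = Ω-ext _ _ (mk⇔ (λ q → meet-to q v) λ q → meet-from λ w →
          ⟦⟧-stable (f w) λ k →
          ∇₀-value-unique (χ a) v w λ v≡w → k (subst (⟦_⟧ ∘ f) v≡w q))

    η-¬¬surjective : {X : Set} (z : ○ X) → ¬ ¬ (Σ[ x ∈ X ] z ≡ η x)
    η-¬¬surjective {X} = modal-ind modality (λ z → ¬ ¬ (Σ[ x ∈ X ] z ≡ η x))
      (λ _ → ¬-modal) λ x k → k (x , refl)

    -- The predicate `¬ ¬ (x ≡ _)` is a map into the modal type `Ω`, so it factors through `η`.
    η-¬¬injective : {X : Set} {x y : X} → η x ≡ η y → ¬ ¬ (x ≡ y)
    η-¬¬injective {X} {x} {y} e = Equivalence.to (¬-code⇔ _) (subst ⟦_⟧ same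
      (Equivalence.from (¬-code⇔ _) λ k → k refl))
      where
      equals : X → Ω
      equals y = ¬-code (¬ (x ≡ y))

      same : equals x ≡ equals y
      same = trans (sym (modal-rec-η modality Ω-modal equals x))
        (trans (cong (modal-rec modality Ω-modal equals) e)
          (modal-rec-η modality Ω-modal equals y))

  -- Runs of coded computations.

  module _ (C : PartialFunctions) (θ : ℕ ↔ (ℕ ⊎ ℕ × ℕ)) where

    open Computability C

    module _ (χ : Oracle ℕ ℕ) where

      open Coding θ χ
      open Nullification (oracleModality χ)

      ψ-steps-query : ∀ {n b} → χ n ↓= b → ∀ k ks e →
                      ψ-steps (k ∷ ks) (inj₂ (n , e)) ≡ ψ-next ks (φ k e b)
      ψ-steps-query {n} {b} p k ks e =
        trans (cong (λ w → bind w λ (b , _) → ψ-next ks (φ k e b))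
                (generator-η (oracleModality χ) n (b , p)))
              (○-comp _ _ (b , p))

      nothing≢just : {n : ℕ} → ¬ (η nothing ≡ η (just n))
      nothing≢just e = η-¬¬injective χ e λ ()

      -- The goal is a negation, so at each query an actual answer may be assumed; both runs then
      -- continue with the same code.
      ψ-steps-unique : ∀ ks ks′ x {n n′} → ψ-steps ks x ≡ η (just n) →
                       ψ-steps ks′ x ≡ η (just n′) → ¬ ¬ (n ≡ n′)
      ψ-steps-unique [] [] (inj₁ _) p p′ l =
        η-¬¬injective χ (trans (sym p) p′) (l ∘ just-injective)
      ψ-steps-unique [] _ (inj₂ _) p _ = ⊥-elim (nothing≢just p)
      ψ-steps-unique (_ ∷ _) _ (inj₁ _) p _ = ⊥-elim (nothing≢just p)
      ψ-steps-unique _ (_ ∷ _) (inj₁ _) _ p′ = ⊥-elim (nothing≢just p′)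
      ψ-steps-unique _ [] (inj₂ _) _ p′ = ⊥-elim (nothing≢just p′)
      ψ-steps-unique (k ∷ ks) (k′ ∷ ks′) (inj₂ (m , e)) {n} {n′} p p′ l =
        proj₁ (proj₂ (χ m)) λ (b , q) →
          next b (trans (sym (ψ-steps-query q k ks e)) p)
                 (trans (sym (ψ-steps-query q k′ ks′ e)) p′)
        where
        next : ∀ b → ψ-next ks (φ k e b) ≡ η (just n) →
               ¬ (ψ-next ks′ (φ k′ e b) ≡ η (just n′))
        next b r r′ with φ k e b in eq | φ k′ e b in eq′
        ... | nothing | _       = nothing≢just r
        ... | just _  | nothing = nothing≢just r′
        -- At most one step count makes `φ` converge, so `k` and `k′` agree, and hence `c` and `c′`.
        ... | just c  | just c′ with refl ← φ-unique eq eq′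
                                with refl ← trans (sym eq) eq′ =
          ψ-steps-unique ks ks′ (Inverse.to θ c) r r′ l

      ψ-unique : ∀ {c n n′} → ψ c ↓= η n → ψ c ↓= η n′ → ¬ ¬ (n ≡ n′)
      ψ-unique {c} (d , p) (d′ , p′) l =
        η-¬¬surjective χ d λ where
          ((ks , m , q) , refl) → η-¬¬surjective χ d′ λ where
            ((ks′ , m′ , q′) , refl) →
              η-¬¬injective χ (trans (sym (○-comp _ _ _)) p) λ where
                refl → η-¬¬injective χ (trans (sym (○-comp _ _ _)) p′) λ where
                  refl → ψ-steps-unique ks ks′ (Inverse.to θ c) q q′ l

      -- The double negation lets oracle answers be assumed in proofs and makes the relation codable
      -- in `Ω`.
      Computes : ℕ → ○ ℕ → Set
      Computes c z = ¬ ¬ (ψ c ↓= z)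

      ψ-query : ∀ {n b e c z} → χ n ↓= b → eval e at b ↓= c → ψ c ↓= z →
                Computes (Inverse.from θ (inj₂ (n , e))) z
      ψ-query {n} {b} {e} {c} q (k , φ≡) (d , p) l = η-¬¬surjective χ d λ where
        ((ks , m , r) , refl) → l
          (η (k ∷ ks , m , trans (cong (ψ-steps (k ∷ ks)) (Inverse.strictlyInverseˡ θ _))
                (trans (ψ-steps-query q k ks e) (trans (cong (ψ-next ks) φ≡) r))) ,
           trans (○-comp _ _ _) (trans (sym (○-comp _ _ _)) p))

      ψ-return : ∀ n → ψ (Inverse.from θ (inj₁ n)) ↓= η n
      ψ-return n =
        η ([] , n , cong (ψ-steps []) (Inverse.strictlyInverseˡ θ (inj₁ n))) , ○-comp _ _ _

      -- Codes from computable choice.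

      module _ (cc : ComputableChoice) where

        ψ-complete : (z : ○ ℕ) → ‖ (Σ[ c ∈ ℕ ] Computes c z) ‖
        ψ-complete = modal-ind modality (λ z → ‖ (Σ[ c ∈ ℕ ] Computes c z) ‖)
          (λ z → proposition-modal χ ‖‖-irrelevant (merge z))
          λ n → ∣ Inverse.from θ (inj₁ n) , (λ l → l (ψ-return n)) ∣
          where
          merge : ∀ z n → (χ n ↓ → ‖ (Σ[ c ∈ ℕ ] Computes c z) ‖) →
                  ‖ (Σ[ c ∈ ℕ ] Computes c z) ‖
          merge z n f = ‖‖-rec ‖‖-irrelevant
            (λ (e , g) → ∣ Inverse.from θ (inj₂ (n , e)) , (λ l →
              -- The goal is now absurdity, so an answer `b` and a code for it can both be
              -- extracted.
              proj₁ (proj₂ (χ n)) λ (b , q) → ‖‖-rec (λ ())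
                (λ (c , s) →
                  let d , r = g b λ h → h (c , Equivalence.from (¬-code⇔ _) λ h → h (q , s))
                  in Equivalence.to (¬-code⇔ _) r λ (_ , s′) →
                     s′ λ v → ψ-query q (proj₂ d) v l)
                (f (b , q))) ∣)
            (cc R λ b k →
              ‖‖-rec ‖‖-irrelevant
                (λ (c , s) → ∣ c , Equivalence.from (¬-code⇔ _) (λ h → h (answer b k , s)) ∣)
                (f (b , answer b k)))
            where
            -- The conjunct `χ n ↓= b` confines choice to true answers: `answer` recovers it by
            -- stability, and then `f` supplies a code.
            R : ℕ → ℕ → Ω
            R b c = ¬-code (¬ (χ n ↓= b × Computes c z))

            answer : ∀ b → ¬ ¬ (Σ[ c ∈ ℕ ] ⟦ R b c ⟧) → χ n ↓= b
            answer b k = ⟦⟧-stable _ λ h → k λ (c , r) →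
              Equivalence.to (¬-code⇔ _) r (h ∘ proj₁)

        ψ-uniform : (z : ℕ → ○ ℕ) →
          ‖ (Σ[ e ∈ ℕ ] (∀ n → Σ[ d ∈ eval e at n ↓ ] Computes (proj₁ d) (z n))) ‖
        ψ-uniform z = ‖‖-rec ‖‖-irrelevant
          (λ (e , g) → ∣ e , (λ n →
            let d , r = g n λ k → ‖‖-rec (λ ()) k (code-of n)
            in d , Equivalence.to (¬-code⇔ _) r) ∣)
          (cc (λ n c → ¬-code (¬ (ψ c ↓= z n))) λ n _ → code-of n)
          where
          code-of : ∀ n → ‖ (Σ[ c ∈ ℕ ] ⟦ ¬-code (¬ (ψ c ↓= z n)) ⟧) ‖
          code-of n = ‖‖-rec ‖‖-irrelevant
            (λ (c , s) → ∣ c , Equivalence.from (¬-code⇔ _) s ∣) (ψ-complete (z n))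

    -- The diagonal argument.

    eval-unique : ∀ {e n m m′} → eval e at n ↓= m → eval e at n ↓= m′ → m ≡ m′
    eval-unique (k , p) (k′ , p′) with refl ← φ-unique p p′ =
      just-injective (trans (sym p) p′)

    jump-≰ : ComputableChoice → (χ : Oracle ℕ (Fin 2)) → ¬ (jump θ χ ≤T χ)
    jump-≰ cc χ jump≤χ = ‖‖-rec (λ ()) (λ (e , g) → diagonal e (g e)) (ψ-uniform χ′ cc z)
      where
      χ′ = fromBinary χ
      open Nullification (oracleModality χ′)
      open Coding θ χ′

      -- The type of values of the jump at `n` is a generator of its own modality, hence connected
      -- there, and by reducibility also for `χ`.
      value : ∀ n → ○ (jump θ χ n ↓)
      value n = fromBinary-○ χ
        (proj₁ (jump≤χ (jump θ χ n ↓) (generator-connected (oracleModality (jump θ χ)) n)))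

      z : ℕ → ○ ℕ
      z n = ○-map (toℕ ∘ proj₁) (value n)

      diagonal : ∀ e → ¬ (Σ[ d ∈ eval e at e ↓ ] Computes χ′ (proj₁ d) (z e))
      diagonal e (d , s) = s λ s′ → η-¬¬surjective χ′ (value e) λ where
          ((b , q) , value≡) → refute b q
            (subst (ψ proj₁ d ↓=_)
              (trans (cong (○-map (toℕ ∘ proj₁)) value≡) (○-comp _ _ _)) s′)
        where
        refute : ∀ b → jump θ χ e ↓= b → ¬ (ψ proj₁ d ↓= η (toℕ b))
        -- Answer 0 denies that the code returns 0, yet it does. Answer 1 says, up to double
        -- negation, that it returns 0, yet it returns 1.
        refute zero       q v = Equivalence.to (¬-code⇔ _) q ∣ d , v ∣
        refute (suc zero) q v = Equivalence.to (¬-code⇔ _) q (‖‖-rec (λ ()) λ (d′ , v′) →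
          ψ-unique χ′ v
            (subst (λ c → ψ c ↓= η 0) (eval-unique (proj₂ d′) (proj₂ d)) v′) λ ())

mainTheorem19 :
    (F : Foundations) (C : PartialFunctions) (θ : ℕ ↔ (ℕ ⊎ ℕ × ℕ)) →
    let open Oracles F
        open Computability C
    in ComputableChoice → MarkovInduction →
       (χ : Oracle ℕ (Fin 2)) → ¬ (jump θ χ ≤T χ)
mainTheorem19 F C θ cc _ = jump-≰ F C θ cc
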